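{- Let $E: y^2 = x^3 + a_4x + a_6$ with $a_4,a_6\in\mathbb{Z}$ be an elliptic curve over $\mathbb{Q}$, let $(u,v)\in\mathbb{Z}^2$ be map-suitable for $E$ with $-D_E(u,v)$ a negative fundamental discriminant, and put $d := d_E(u,v)$. Let $P_1,P_2,P_3\in E(\mathbb{Q})\setminus\{\mathcal{O}\}$ with $P_1+P_2+P_3=\mathcal{O}$, written $P_i = (A_i/C_i^2, B_i/C_i^3)$ with $A_i,B_i,C_i\in\mathbb{Z}$, $\gcd(A_i,C_i)=\gcd(B_i,C_i)=1$, $C_i>0$, and let $ly = mx+n$ ($l,m,n\in\mathbb{Z}$) be the line meeting $E$ exactly in $P_1,P_2,P_3$ counted with multiplicity. Set $C := C_1C_2C_3$, $M := Cm/l$, $N := Cn/l$, $b := Nv-Mu$, $a_i := A_iv + C_i^2u$. Then $$a_1a_2a_3v = b^2v^2 + C^2d,\qquad A_1A_2A_3 = N^2 - a_6C^2,$$ $$a_2a_3C_1^2 + a_1a_3C_2^2 + a_1a_2C_3^2 = -2Mbv + C^2(3u^2 + a_4v^2),$$ $$A_2A_3C_1^2 + A_1A_3C_2^2 + A_1A_2C_3^2 = -2MN + a_4C^2,$$ $$a_1C_2^2C_3^2 + a_2C_1^2C_3^2 + a_3C_1^2C_2^2 = M^2v + 3C^2u,$$ $$A_1C_2^2C_3^2 + A_2C_1^2C_3^2 + A_3C_1^2C_2^2 = M^2.$$ Furthermore, for any distinct $i,j,k\in\{1,2,3\}$, $$C_iC_j \mid MN + A_iA_jC_k^2\quad\text{and}\quad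 C_iC_j \mid A_iA_jM + A_iC_j^2N + A_jC_i^2N.$$
   Context: Notation: $d_E(u,v) := v(u^3 + a_4uv^2 - a_6v^3)$ and $D_E(u,v) := 4d_E(u,v)$. A pair $(u,v)\in\mathbb{Z}^2$ is map-suitable for $E$ if $u$, $v$, $3u^2+a_4v^2$ and $D_E(u,v)$ are all positive. -}

module Defs where

open import Data.Nat using (ℕ)
open import Data.Integer as ℤ using (ℤ; +_; ∣_∣)
open import Data.Integer.Divisibility using (_∣_)
open import Data.Rational as ℚ using (ℚ; 0ℚ; _÷_; ≢-nonZero)
open import Data.Rational.Properties using (_≟_)
open import Data.Product using (_×_; _,_; Σ)
open import Data.Sum using (_⊎_)
open import Relation.Nullary using (¬_; yes; no)
open import Relation.Binary.PropositionalEquality using (_≡_; _≢_)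

ι : ℤ → ℚ
ι z = z ℚ./ 1

IsElliptic : ℤ → ℤ → Set
IsElliptic a4 a6 = (+ 4) ℤ.* (a4 ℤ.* a4 ℤ.* a4) ℤ.+ (+ 27) ℤ.* (a6 ℤ.* a6) ≢ + 0

data Pt : Set where
  𝒪  : Pt
  af : ℚ → ℚ → Pt

OnCurve : ℤ → ℤ → ℚ → ℚ → Set
OnCurve a4 a6 x y = y ℚ.* y ≡ x ℚ.* x ℚ.* x ℚ.+ ι a4 ℚ.* x ℚ.+ ι a6

-- chord-and-tangent group law (correct for points on the curve)
-- third intersection reflected, given slope s through (x₁,y₁) and abscissa x₂
thirdPt : ℚ → ℚ → ℚ → ℚ → Pt
thirdPt s x₁ y₁ x₂ = af x₃ (s ℚ.* (x₁ ℚ.- x₃) ℚ.- y₁)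
  where x₃ = s ℚ.* s ℚ.- x₁ ℚ.- x₂

addPt : ℤ → Pt → Pt → Pt
addPt a4 𝒪 Q = Q
addPt a4 (af x₁ y₁) 𝒪 = af x₁ y₁
addPt a4 (af x₁ y₁) (af x₂ y₂) with x₂ ℚ.- x₁ ≟ 0ℚ
... | no dx≢0 =
  thirdPt (_÷_ (y₂ ℚ.- y₁) (x₂ ℚ.- x₁) {{≢-nonZero dx≢0}}) x₁ y₁ x₂
... | yes _ with y₁ ℚ.+ y₂ ≟ 0ℚ
...   | yes _ = 𝒪
-- here (on the curve) y₂ = y₁ ≠ 0, so y₁ + y₂ = 2y₁ : tangent slope
...   | no sy≢0 =
  thirdPt (_÷_ (ι (+ 3) ℚ.* x₁ ℚ.* x₁ ℚ.+ ι a4) (y₁ ℚ.+ y₂) {{≢-nonZero sy≢0}}) x₁ y₁ x₂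

dE : ℤ → ℤ → ℤ → ℤ → ℤ
dE a4 a6 u v = v ℤ.* (u ℤ.* u ℤ.* u ℤ.+ a4 ℤ.* u ℤ.* v ℤ.* v ℤ.- a6 ℤ.* v ℤ.* v ℤ.* v)

DE : ℤ → ℤ → ℤ → ℤ → ℤ
DE a4 a6 u v = + 4 ℤ.* dE a4 a6 u v

MapSuitable : ℤ → ℤ → ℤ → ℤ → Set
MapSuitable a4 a6 u v =
  (+ 0 ℤ.< u) × (+ 0 ℤ.< v) × (+ 0 ℤ.< (+ 3) ℤ.* u ℤ.* u ℤ.+ a4 ℤ.* v ℤ.* v)
  × (+ 0 ℤ.< DE a4 a6 u v)

SquareFree : ℤ → Set
SquareFree m = ∀ (k : ℤ) → (k ℤ.* k) ∣ m → ∣ k ∣ ≡ 1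

FundamentalDisc : ℤ → Set
FundamentalDisc D =
  (((+ 4) ∣ (D ℤ.- + 1)) × SquareFree D)
  ⊎ Σ ℤ (λ m → (D ≡ + 4 ℤ.* m) × (((+ 4) ∣ (m ℤ.- + 2)) ⊎ ((+ 4) ∣ (m ℤ.- + 3))) × SquareFree m)

NegFundamentalDisc : ℤ → Set
NegFundamentalDisc D = (D ℤ.< + 0) × FundamentalDisc D

-- The line l y = m x + n meets E exactly in (x₁,y₁),(x₂,y₂),(x₃,y₃)
-- counted with multiplicity: l ≠ 0 (a line with l = 0 is vertical and
-- also passes through 𝒪), each point lies on the line, and
--   l²(x³ + a₄x + a₆) − (mx + n)² = l²(x − x₁)(x − x₂)(x − x₃)
-- as polynomials in x, written out coefficientwise (x², x¹, x⁰).
LineMeetsExactly : ℤ → ℤ → (l m n : ℤ) → (x₁ y₁ x₂ y₂ x₃ y₃ : ℚ) → Set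
LineMeetsExactly a4 a6 l m n x₁ y₁ x₂ y₂ x₃ y₃ =
  (l ≢ + 0)
  × (ι l ℚ.* y₁ ≡ ι m ℚ.* x₁ ℚ.+ ι n)
  × (ι l ℚ.* y₂ ≡ ι m ℚ.* x₂ ℚ.+ ι n)
  × (ι l ℚ.* y₃ ≡ ι m ℚ.* x₃ ℚ.+ ι n)
  × (ℚ.- (ι m ℚ.* ι m) ≡ ℚ.- (L2 ℚ.* (x₁ ℚ.+ x₂ ℚ.+ x₃)))
  × (L2 ℚ.* ι a4 ℚ.- ι (+ 2) ℚ.* ι m ℚ.* ι n
       ≡ L2 ℚ.* (x₁ ℚ.* x₂ ℚ.+ x₁ ℚ.* x₃ ℚ.+ x₂ ℚ.* x₃))
  × (L2 ℚ.* ι a6 ℚ.- ι n ℚ.* ι n ≡ ℚ.- (L2 ℚ.* (x₁ ℚ.* x₂ ℚ.* x₃)))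
  where L2 = ι l ℚ.* ι l

module Submission where

-- Multiplying the Vieta relations of l y = m x + n by C² = (C₁C₂C₃)² makes them integral:
-- (Cm)² = l²σ₁, (Cn)² = l²(σ₃ + a₆C²) and l²a₄C² − 2(Cm)(Cn) = l²σ₂, where σᵣ is C² times the
-- r-th elementary symmetric function of the xᵢ = Aᵢ/Cᵢ². Hence M = Cm/l and N = Cn/l are integers
-- with M² = σ₁, N² = σ₃ + a₆C² and σ₂ = a₄C² − 2MN; the identities for the aᵢ follow from these
-- by the substitution x ↦ vx + u. Clearing denominators in l yₖ = m xₖ + n gives
-- M Aₖ + N Cₖ² = CᵢCⱼBₖ, and together with the curve equation at Pₖ this yields identities
-- T Cₖ²ʳ = CᵢCⱼ X in which Cₖ²ʳ ∣ X because Aₖ is invertible modulo Cₖ; so CᵢCⱼ ∣ T.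

open import Data.Fin using (Fin; zero; suc)
open import Data.Integer as ℤ using (ℤ; +_; _+_; _-_; _*_; -_; _<_)
import Data.Integer.Coprimality as ℤ
open import Data.Integer.Divisibility using (_∣_)
import Data.Integer.Divisibility as ℤ
import Data.Integer.Divisibility.Signed as ℤS
open import Data.Integer.GCD using (gcd)
import Data.Integer.Properties as ℤ
open import Data.Integer.Tactic.RingSolver using (solve-∀; solve)
open import Data.List using (_∷_; [])
import Data.Nat as ℕ
import Data.Nat.Coprimality as ℕ
import Data.Nat.Divisibility as ℕ
import Data.Nat.DivMod as ℕ
import Data.Nat.GCD as ℕ
import Data.Nat.Properties as ℕ
open import Data.Product using (Σ; Σ-syntax; _×_; _,_; proj₁; proj₂)
open import Data.Rational as ℚ using (ℚ; 0ℚ)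
import Data.Rational.Properties as ℚ
open import Data.Rational.Unnormalised as ℚᵘ using (mkℚᵘ; *≡*)
import Data.Rational.Unnormalised.Properties as ℚᵘ
open import Data.Sum using (inj₁)
open import Function using (_∘_)
open import Level using (0ℓ)
open import Relation.Binary.PropositionalEquality
open import Relation.Nullary using (contradiction)
open import Relation.Nullary.Decidable using (dec⇒maybe)
import Tactic.RingSolver as RingSolver
open import Tactic.RingSolver.Core.AlmostCommutativeRing using (AlmostCommutativeRing; fromCommutativeRing)

open import Defs

ℚ-ring : AlmostCommutativeRing 0ℓ 0ℓ
ℚ-ring = fromCommutativeRing ℚ.+-*-commutativeRing (λ q → dec⇒maybe (0ℚ ℚ.≟ q))

cong₃ : ∀ {A B C D : Set} (f : A → B → C → D) {a a′ b b′ c c′} → a ≡ a′ → b ≡ b′ → c ≡ c′ → f a b c ≡ f a′ b′ c′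
cong₃ f refl refl refl = refl

ι-toℚᵘ : ∀ z → ℚ.toℚᵘ (ι z) ℚᵘ.≃ mkℚᵘ z 0
ι-toℚᵘ z = ℚ.toℚᵘ-fromℚᵘ (mkℚᵘ z 0)

ι-injective : ∀ {a b} → ι a ≡ ι b → a ≡ b
ι-injective {a} {b} ιa≡ιb with ℚ.fromℚᵘ-injective {mkℚᵘ a 0} {mkℚᵘ b 0} ιa≡ιb
... | *≡* a*1≡b*1 = trans (sym (ℤ.*-identityʳ a)) (trans a*1≡b*1 (ℤ.*-identityʳ b))

ι-homo-+ : ∀ a b → ι (a + b) ≡ ι a ℚ.+ ι b
ι-homo-+ a b = ℚ.toℚᵘ-injective (begin
  ℚ.toℚᵘ (ι (a + b))                 ≈⟨ ι-toℚᵘ (a + b) ⟩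
  mkℚᵘ (a + b) 0                     ≈⟨ *≡* (cong (_* + 1) (cong₂ _+_ (sym (ℤ.*-identityʳ a)) (sym (ℤ.*-identityʳ b)))) ⟩
  mkℚᵘ a 0 ℚᵘ.+ mkℚᵘ b 0             ≈⟨ ℚᵘ.+-cong (ι-toℚᵘ a) (ι-toℚᵘ b) ⟨
  ℚ.toℚᵘ (ι a) ℚᵘ.+ ℚ.toℚᵘ (ι b)     ≈⟨ ℚ.toℚᵘ-homo-+ (ι a) (ι b) ⟨
  ℚ.toℚᵘ (ι a ℚ.+ ι b)               ∎)
  where open ℚᵘ.≃-Reasoning

ι-homo-* : ∀ a b → ι (a * b) ≡ ι a ℚ.* ι b
ι-homo-* a b = ℚ.toℚᵘ-injective (begin
  ℚ.toℚᵘ (ι (a * b))                 ≈⟨ ι-toℚᵘ (a * b) ⟩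
  mkℚᵘ a 0 ℚᵘ.* mkℚᵘ b 0             ≈⟨ ℚᵘ.*-cong (ι-toℚᵘ a) (ι-toℚᵘ b) ⟨
  ℚ.toℚᵘ (ι a) ℚᵘ.* ℚ.toℚᵘ (ι b)     ≈⟨ ℚ.toℚᵘ-homo-* (ι a) (ι b) ⟨
  ℚ.toℚᵘ (ι a ℚ.* ι b)               ∎)
  where open ℚᵘ.≃-Reasoning

ι-homo-‿- : ∀ a → ι (- a) ≡ ℚ.- ι a
ι-homo-‿- a = ℚ.toℚᵘ-injective (begin
  ℚ.toℚᵘ (ι (- a))                   ≈⟨ ι-toℚᵘ (- a) ⟩
  ℚᵘ.- mkℚᵘ a 0                      ≈⟨ ℚᵘ.-‿cong (ι-toℚᵘ a) ⟨
  ℚᵘ.- ℚ.toℚᵘ (ι a)                  ≈⟨ ℚ.toℚᵘ-homo‿- (ι a) ⟨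
  ℚ.toℚᵘ (ℚ.- ι a)                   ∎)
  where open ℚᵘ.≃-Reasoning

infixl 6 _⊕_
infixl 7 _⊗_
infix  8 ⊝_
infix  10 ‵_

data Expr : Set where
  ‵_      : ℤ → Expr
  _⊕_ _⊗_ : Expr → Expr → Expr
  ⊝_      : Expr → Expr

⟦_⟧ℤ : Expr → ℤ
⟦ ‵ z ⟧ℤ   = z
⟦ s ⊕ t ⟧ℤ = ⟦ s ⟧ℤ + ⟦ t ⟧ℤ
⟦ s ⊗ t ⟧ℤ = ⟦ s ⟧ℤ * ⟦ t ⟧ℤ
⟦ ⊝ t ⟧ℤ   = - ⟦ t ⟧ℤ

⟦_⟧ℚ : Expr → ℚ
⟦ ‵ z ⟧ℚ   = ι z
⟦ s ⊕ t ⟧ℚ = ⟦ s ⟧ℚ ℚ.+ ⟦ t ⟧ℚ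
⟦ s ⊗ t ⟧ℚ = ⟦ s ⟧ℚ ℚ.* ⟦ t ⟧ℚ
⟦ ⊝ t ⟧ℚ   = ℚ.- ⟦ t ⟧ℚ

ι-⟦⟧ : ∀ t → ι ⟦ t ⟧ℤ ≡ ⟦ t ⟧ℚ
ι-⟦⟧ (‵ z)   = refl
ι-⟦⟧ (s ⊕ t) = trans (ι-homo-+ ⟦ s ⟧ℤ ⟦ t ⟧ℤ) (cong₂ ℚ._+_ (ι-⟦⟧ s) (ι-⟦⟧ t))
ι-⟦⟧ (s ⊗ t) = trans (ι-homo-* ⟦ s ⟧ℤ ⟦ t ⟧ℤ) (cong₂ ℚ._*_ (ι-⟦⟧ s) (ι-⟦⟧ t))
ι-⟦⟧ (⊝ t)   = trans (ι-homo-‿- ⟦ t ⟧ℤ) (cong ℚ.-_ (ι-⟦⟧ t))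

⟦⟧ℤ-≡-from-ℚ : ∀ s t → ⟦ s ⟧ℚ ≡ ⟦ t ⟧ℚ → ⟦ s ⟧ℤ ≡ ⟦ t ⟧ℤ
⟦⟧ℤ-≡-from-ℚ s t eq = ι-injective (trans (ι-⟦⟧ s) (trans eq (sym (ι-⟦⟧ t))))

m*m∣n*n⇒m∣n : ∀ m n .{{_ : ℕ.NonZero m}} → m ℕ.* m ℕ.∣ n ℕ.* n → m ℕ.∣ n
m*m∣n*n⇒m∣n m n m²∣n² = subst (ℕ._∣ n) g≡m (ℕ.gcd[m,n]∣n m n)
  where
  g : ℕ.ℕ
  g = ℕ.gcd m n
  instance
    g≢0 : ℕ.NonZero g
    g≢0 = ℕ.≢-nonZero (ℕ.gcd[m,n]≢0 m n (inj₁ (ℕ.≢-nonZero⁻¹ m)))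
    g*g≢0 : ℕ.NonZero (g ℕ.* g)
    g*g≢0 = ℕ.m*n≢0 g g
  m′ n′ : ℕ.ℕ
  m′ = m ℕ./ g
  n′ = n ℕ./ g
  m′*g≡m : m′ ℕ.* g ≡ m
  m′*g≡m = ℕ.m/n*n≡m (ℕ.gcd[m,n]∣m m n)
  n′*g≡n : n′ ℕ.* g ≡ n
  n′*g≡n = ℕ.m/n*n≡m (ℕ.gcd[m,n]∣n m n)
  coprime : ℕ.Coprime m′ n′
  coprime = ℕ.coprime-/gcd m n
  square-of : ∀ k′ {k} → k′ ℕ.* g ≡ k → k ℕ.* k ≡ k′ ℕ.* k′ ℕ.* (g ℕ.* g)
  square-of k′ refl = ℕ.[m*n]*[o*p]≡[m*o]*[n*p] k′ g k′ g
  m′²∣n′² : m′ ℕ.* m′ ℕ.∣ n′ ℕ.* n′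
  m′²∣n′² = ℕ.*-cancelʳ-∣ (g ℕ.* g) (subst₂ ℕ._∣_ (square-of m′ m′*g≡m) (square-of n′ n′*g≡n) m²∣n²)
  m′≡1 : m′ ≡ 1
  m′≡1 = coprime (ℕ.∣-refl , ℕ.coprime-divisor coprime (ℕ.∣-trans (ℕ.m∣m*n m′) m′²∣n′²))
  g≡m : g ≡ m
  g≡m = trans (sym (ℕ.*-identityˡ g)) (trans (cong (ℕ._* g) (sym m′≡1)) m′*g≡m)

quotient-of-squares : ∀ l X T → l ≢ + 0 → X * X ≡ l * l * T → Σ[ M ∈ ℤ ] (M * l ≡ X × M * M ≡ T)
quotient-of-squares l X T l≢0 X²≡l²T = M , sym X≡Ml , M²≡T
  where
  instance
    ∣l∣≢0 : ℕ.NonZero ℤ.∣ l ∣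
    ∣l∣≢0 = ℕ.≢-nonZero (l≢0 ∘ ℤ.∣i∣≡0⇒i≡0)
    l≢0′ : ℤ.NonZero l
    l≢0′ = ℤ.≢-nonZero l≢0
    l*l≢0 : ℤ.NonZero (l * l)
    l*l≢0 = ℤ.i*j≢0 l l
  ∣X∣² : ℤ.∣ X ∣ ℕ.* ℤ.∣ X ∣ ≡ ℤ.∣ T ∣ ℕ.* (ℤ.∣ l ∣ ℕ.* ℤ.∣ l ∣)
  ∣X∣² = begin
    ℤ.∣ X ∣ ℕ.* ℤ.∣ X ∣                 ≡⟨ ℤ.abs-* X X ⟨
    ℤ.∣ X * X ∣                         ≡⟨ cong ℤ.∣_∣ X²≡l²T ⟩
    ℤ.∣ l * l * T ∣                     ≡⟨ ℤ.abs-* (l * l) T ⟩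
    ℤ.∣ l * l ∣ ℕ.* ℤ.∣ T ∣             ≡⟨ cong (ℕ._* ℤ.∣ T ∣) (ℤ.abs-* l l) ⟩
    ℤ.∣ l ∣ ℕ.* ℤ.∣ l ∣ ℕ.* ℤ.∣ T ∣     ≡⟨ ℕ.*-comm _ ℤ.∣ T ∣ ⟩
    ℤ.∣ T ∣ ℕ.* (ℤ.∣ l ∣ ℕ.* ℤ.∣ l ∣)   ∎
    where open ≡-Reasoning
  l∣X : l ℤS.∣ X
  l∣X = ℤS.∣ᵤ⇒∣ (m*m∣n*n⇒m∣n ℤ.∣ l ∣ ℤ.∣ X ∣ (ℕ.divides ℤ.∣ T ∣ ∣X∣²))
  M : ℤ
  M = ℤS.quotient l∣X
  X≡Ml : X ≡ M * l
  X≡Ml = ℤS._∣_.equality l∣X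
  interchange : ∀ l M → l * l * (M * M) ≡ M * l * (M * l)
  interchange = solve-∀
  M²≡T : M * M ≡ T
  M²≡T = ℤ.*-cancelˡ-≡ (l * l) (M * M) T (begin
    l * l * (M * M)       ≡⟨ interchange l M ⟩
    M * l * (M * l)       ≡⟨ cong₂ _*_ X≡Ml X≡Ml ⟨
    X * X                 ≡⟨ X²≡l²T ⟩
    l * l * T             ∎)
    where open ≡-Reasoning

combination₂ : ∀ {a b p p′ q q′ : ℤ} c d → a ≡ b + (c * (p - p′) + d * (q - q′)) → p ≡ p′ → q ≡ q′ → a ≡ b
combination₂ {b = b} {p} {q = q} c d a≡b+… refl refl = trans a≡b+… (vanish b c d p q)
  where
  vanish : ∀ b c d p q → b + (c * (p - p) + d * (q - q)) ≡ b
  vanish = solve-∀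

combination₃ : ∀ {a b p p′ q q′ r r′ : ℤ} c d e → a ≡ b + (c * (p - p′) + d * (q - q′) + e * (r - r′))
             → p ≡ p′ → q ≡ q′ → r ≡ r′ → a ≡ b
combination₃ {b = b} {p} {q = q} {r = r} c d e a≡b+… refl refl refl = trans a≡b+… (vanish b c d e p q r)
  where
  vanish : ∀ b c d e p q r → b + (c * (p - p) + d * (q - q) + e * (r - r)) ≡ b
  vanish = solve-∀

coprime-square : ∀ c a → ℤ.Coprime c a → ℤ.Coprime (c * c) a
coprime-square c a c⊥a rewrite ℤ.abs-* c c = λ (d∣c² , d∣a) → c⊥a (d∣c d∣c² d∣a , d∣a)
  where
  d∣c : ∀ {d} → d ℕ.∣ ℤ.∣ c ∣ ℕ.* ℤ.∣ c ∣ → d ℕ.∣ ℤ.∣ a ∣ → d ℕ.∣ ℤ.∣ c ∣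
  d∣c d∣c² d∣a = ℕ.coprime-divisor (λ (e∣d , e∣c) → c⊥a (e∣c , ℕ.∣-trans e∣d d∣a)) d∣c²

coprime-*≡*⇒∣ : ∀ K a X {W} → ℤ.Coprime K a → a * X ≡ K * W → K ∣ X
coprime-*≡*⇒∣ K a X {W} K⊥a aX≡KW =
  ℤ.coprime-divisor K a X K⊥a (ℤS.∣⇒∣ᵤ (ℤS.divides W (trans aX≡KW (ℤ.*-comm K W))))

*≡*∧∣⇒∣ : ∀ D T X K .{{_ : ℤ.NonZero K}} → T * K ≡ D * X → K ∣ X → D ∣ T
*≡*∧∣⇒∣ D T X K TK≡DX K∣X = ℤ.*-cancelʳ-∣ K {D} {T} (subst (D * K ∣_) (sym TK≡DX) (ℤ.*-monoʳ-∣ D {K} {X} K∣X))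

module _ (x y : ℚ) (A B C : ℤ) (x*C²≡A : x ℚ.* ι (C * C) ≡ ι A) (y*C³≡B : y ℚ.* ι (C * C * C) ≡ ι B) where

  private
    c : ℚ
    c = ι C
    x*c²≡A : x ℚ.* (c ℚ.* c) ≡ ι A
    x*c²≡A = trans (cong (x ℚ.*_) (sym (ι-⟦⟧ (‵ C ⊗ ‵ C)))) x*C²≡A
    y*c³≡B : y ℚ.* (c ℚ.* c ℚ.* c) ≡ ι B
    y*c³≡B = trans (cong (y ℚ.*_) (sym (ι-⟦⟧ (‵ C ⊗ ‵ C ⊗ ‵ C)))) y*C³≡B

  integral-onCurve : ∀ a4 a6 → OnCurve a4 a6 x y
                   → B * B ≡ A * A * A + a4 * A * (C * C * (C * C)) + a6 * (C * C * C * (C * C * C))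
  integral-onCurve a4 a6 y²≡x³+a4x+a6 = ⟦⟧ℤ-≡-from-ℚ (‵ B ⊗ ‵ B)
    (‵ A ⊗ ‵ A ⊗ ‵ A ⊕ ‵ a4 ⊗ ‵ A ⊗ (‵ C ⊗ ‵ C ⊗ (‵ C ⊗ ‵ C)) ⊕ ‵ a6 ⊗ (‵ C ⊗ ‵ C ⊗ ‵ C ⊗ (‵ C ⊗ ‵ C ⊗ ‵ C)))
    (begin
      ι B ℚ.* ι B                                         ≡⟨ cong₂ ℚ._*_ y*c³≡B y*c³≡B ⟨
      y ℚ.* c³ ℚ.* (y ℚ.* c³)                             ≡⟨ regroup y c ⟩
      y ℚ.* y ℚ.* c⁶                                      ≡⟨ cong (ℚ._* c⁶) y²≡x³+a4x+a6 ⟩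
      (x ℚ.* x ℚ.* x ℚ.+ ι a4 ℚ.* x ℚ.+ ι a6) ℚ.* c⁶      ≡⟨ homogenise x c (ι a4) (ι a6) ⟩
      weighted (x ℚ.* (c ℚ.* c))                          ≡⟨ cong weighted x*c²≡A ⟩
      weighted (ι A)                                      ∎)
    where
    open ≡-Reasoning
    c³ c⁶ : ℚ
    c³ = c ℚ.* c ℚ.* c
    c⁶ = c³ ℚ.* c³
    weighted : ℚ → ℚ
    weighted X = X ℚ.* X ℚ.* X ℚ.+ ι a4 ℚ.* X ℚ.* (c ℚ.* c ℚ.* (c ℚ.* c)) ℚ.+ ι a6 ℚ.* c⁶
    regroup : ∀ y c → y ℚ.* (c ℚ.* c ℚ.* c) ℚ.* (y ℚ.* (c ℚ.* c ℚ.* c)) ≡ y ℚ.* y ℚ.* (c ℚ.* c ℚ.* c ℚ.* (c ℚ.* c ℚ.* c))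
    regroup = RingSolver.solve-∀ ℚ-ring
    homogenise : ∀ x c α β → (x ℚ.* x ℚ.* x ℚ.+ α ℚ.* x ℚ.+ β) ℚ.* (c ℚ.* c ℚ.* c ℚ.* (c ℚ.* c ℚ.* c))
               ≡ x ℚ.* (c ℚ.* c) ℚ.* (x ℚ.* (c ℚ.* c)) ℚ.* (x ℚ.* (c ℚ.* c)) ℚ.+ α ℚ.* (x ℚ.* (c ℚ.* c)) ℚ.* (c ℚ.* c ℚ.* (c ℚ.* c))
                 ℚ.+ β ℚ.* (c ℚ.* c ℚ.* c ℚ.* (c ℚ.* c ℚ.* c))
    homogenise = RingSolver.solve-∀ ℚ-ring

  integral-onLine : ∀ l m n → ι l ℚ.* y ≡ ι m ℚ.* x ℚ.+ ι n → l * B ≡ C * (m * A + n * (C * C))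
  integral-onLine l m n ly≡mx+n = ⟦⟧ℤ-≡-from-ℚ (‵ l ⊗ ‵ B) (‵ C ⊗ (‵ m ⊗ ‵ A ⊕ ‵ n ⊗ (‵ C ⊗ ‵ C)))
    (begin
      ι l ℚ.* ι B                                         ≡⟨ cong (ι l ℚ.*_) y*c³≡B ⟨
      ι l ℚ.* (y ℚ.* (c ℚ.* c ℚ.* c))                     ≡⟨ regroup (ι l) y c ⟩
      ι l ℚ.* y ℚ.* (c ℚ.* c ℚ.* c)                       ≡⟨ cong (ℚ._* (c ℚ.* c ℚ.* c)) ly≡mx+n ⟩
      (ι m ℚ.* x ℚ.+ ι n) ℚ.* (c ℚ.* c ℚ.* c)             ≡⟨ homogenise (ι m) x (ι n) c ⟩
      weighted (x ℚ.* (c ℚ.* c))                          ≡⟨ cong weighted x*c²≡A ⟩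
      weighted (ι A)                                      ∎)
    where
    open ≡-Reasoning
    weighted : ℚ → ℚ
    weighted X = c ℚ.* (ι m ℚ.* X ℚ.+ ι n ℚ.* (c ℚ.* c))
    regroup : ∀ l y c → l ℚ.* (y ℚ.* (c ℚ.* c ℚ.* c)) ≡ l ℚ.* y ℚ.* (c ℚ.* c ℚ.* c)
    regroup = RingSolver.solve-∀ ℚ-ring
    homogenise : ∀ m x n c → (m ℚ.* x ℚ.+ n) ℚ.* (c ℚ.* c ℚ.* c) ≡ c ℚ.* (m ℚ.* (x ℚ.* (c ℚ.* c)) ℚ.+ n ℚ.* (c ℚ.* c))
    homogenise = RingSolver.solve-∀ ℚ-ring

integral-onScaledLine : ∀ l m n P D Cₖ M N A B → l ≢ + 0 → M * l ≡ P * m → N * l ≡ P * n → P ≡ D * Cₖ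
                      → l * B ≡ Cₖ * (m * A + n * (Cₖ * Cₖ)) → M * A + N * (Cₖ * Cₖ) ≡ D * B
integral-onScaledLine l m n P D Cₖ M N A B l≢0 Ml≡Pm Nl≡Pn P≡DCₖ lB≡… =
  ℤ.*-cancelˡ-≡ l (M * A + N * (Cₖ * Cₖ)) (D * B) (begin
    l * (M * A + N * (Cₖ * Cₖ))            ≡⟨ solve (l ∷ M ∷ N ∷ A ∷ Cₖ ∷ []) ⟩
    M * l * A + N * l * (Cₖ * Cₖ)          ≡⟨ cong₂ (λ s t → s * A + t * (Cₖ * Cₖ)) Ml≡Pm Nl≡Pn ⟩
    P * m * A + P * n * (Cₖ * Cₖ)          ≡⟨ cong (λ Q → Q * m * A + Q * n * (Cₖ * Cₖ)) P≡DCₖ ⟩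
    D * Cₖ * m * A + D * Cₖ * n * (Cₖ * Cₖ) ≡⟨ solve (D ∷ Cₖ ∷ m ∷ n ∷ A ∷ []) ⟩
    D * (Cₖ * (m * A + n * (Cₖ * Cₖ)))     ≡⟨ cong (D *_) lB≡… ⟨
    D * (l * B)                            ≡⟨ solve (D ∷ l ∷ B ∷ []) ⟩
    l * (D * B)                            ∎)
  where
  open ≡-Reasoning
  instance
    l≢0′ : ℤ.NonZero l
    l≢0′ = ℤ.≢-nonZero l≢0

pattern 0F = zero
pattern 1F = suc zero
pattern 2F = suc (suc zero)

-- (C i C j C k)² times the elementary symmetric functions of the abscissae x = A / C².
σ₁ σ₂ σ₃ : (A C : Fin 3 → ℤ) (i j k : Fin 3) → ℤ
σ₁ A C i j k = A i * (C j * C j) * (C k * C k) + A j * (C i * C i) * (C k * C k) + A k * (C i * C i) * (C j * C j)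
σ₂ A C i j k = A j * A k * (C i * C i) + A i * A k * (C j * C j) + A i * A j * (C k * C k)
σ₃ A C i j k = A i * A j * A k

π₃ : (C : Fin 3 → ℤ) (i j k : Fin 3) → ℤ
π₃ C i j k = C i * C j * C k

module _ (x : Fin 3 → ℚ) (A C : Fin 3 → ℤ) (x*C²≡A : ∀ i → x i ℚ.* ι (C i * C i) ≡ ι (A i)) (l m n : ℤ) where

  private
    c : Fin 3 → ℚ
    c i = ι (C i)
    p L : ℚ
    p = c 0F ℚ.* c 1F ℚ.* c 2F
    L = ι l ℚ.* ι l
    X : Fin 3 → ℚ
    X i = x i ℚ.* (c i ℚ.* c i)
    X≡A : ∀ (f : ℚ → ℚ → ℚ → ℚ) → f (X 0F) (X 1F) (X 2F) ≡ f (ι (A 0F)) (ι (A 1F)) (ι (A 2F))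
    X≡A f = cong₃ f (x*c²≡A 0F) (x*c²≡A 1F) (x*c²≡A 2F)
      where
      x*c²≡A : ∀ i → X i ≡ ι (A i)
      x*c²≡A i = trans (cong (x i ℚ.*_) (sym (ι-⟦⟧ (‵ C i ⊗ ‵ C i)))) (x*C²≡A i)
    ‵P : Expr
    ‵P = ‵ C 0F ⊗ ‵ C 1F ⊗ ‵ C 2F
    infix 9 _²
    _² : Expr → Expr
    t ² = t ⊗ t

  vieta-σ₁ : ℚ.- (ι m ℚ.* ι m) ≡ ℚ.- (L ℚ.* (x 0F ℚ.+ x 1F ℚ.+ x 2F))
           → (π₃ C 0F 1F 2F * m) * (π₃ C 0F 1F 2F * m) ≡ l * l * σ₁ A C 0F 1F 2F
  vieta-σ₁ −m²≡−Le₁ = ⟦⟧ℤ-≡-from-ℚ ((‵P ⊗ ‵ m) ²)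
    (‵ l ² ⊗ (‵ A 0F ⊗ ‵ C 1F ² ⊗ ‵ C 2F ² ⊕ ‵ A 1F ⊗ ‵ C 0F ² ⊗ ‵ C 2F ² ⊕ ‵ A 2F ⊗ ‵ C 0F ² ⊗ ‵ C 1F ²))
    (begin
      p ℚ.* ι m ℚ.* (p ℚ.* ι m)                ≡⟨ square-* p (ι m) ⟩
      p ℚ.* p ℚ.* (ι m ℚ.* ι m)                ≡⟨ cong (p ℚ.* p ℚ.*_) (ℚ.neg-injective −m²≡−Le₁) ⟩
      p ℚ.* p ℚ.* (L ℚ.* (x 0F ℚ.+ x 1F ℚ.+ x 2F)) ≡⟨ clear (c 0F) (c 1F) (c 2F) L (x 0F) (x 1F) (x 2F) ⟩
      S (X 0F) (X 1F) (X 2F)                     ≡⟨ X≡A S ⟩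
      S (ι (A 0F)) (ι (A 1F)) (ι (A 2F))         ∎)
    where
    open ≡-Reasoning
    S : ℚ → ℚ → ℚ → ℚ
    S a b d = L ℚ.* (a ℚ.* (c 1F ℚ.* c 1F) ℚ.* (c 2F ℚ.* c 2F) ℚ.+ b ℚ.* (c 0F ℚ.* c 0F) ℚ.* (c 2F ℚ.* c 2F) ℚ.+ d ℚ.* (c 0F ℚ.* c 0F) ℚ.* (c 1F ℚ.* c 1F))
    square-* : ∀ p m → p ℚ.* m ℚ.* (p ℚ.* m) ≡ p ℚ.* p ℚ.* (m ℚ.* m)
    square-* = RingSolver.solve-∀ ℚ-ring
    clear : ∀ c₀ c₁ c₂ L x₀ x₁ x₂ → c₀ ℚ.* c₁ ℚ.* c₂ ℚ.* (c₀ ℚ.* c₁ ℚ.* c₂) ℚ.* (L ℚ.* (x₀ ℚ.+ x₁ ℚ.+ x₂))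
          ≡ L ℚ.* (x₀ ℚ.* (c₀ ℚ.* c₀) ℚ.* (c₁ ℚ.* c₁) ℚ.* (c₂ ℚ.* c₂) ℚ.+ x₁ ℚ.* (c₁ ℚ.* c₁) ℚ.* (c₀ ℚ.* c₀) ℚ.* (c₂ ℚ.* c₂)
                   ℚ.+ x₂ ℚ.* (c₂ ℚ.* c₂) ℚ.* (c₀ ℚ.* c₀) ℚ.* (c₁ ℚ.* c₁))
    clear = RingSolver.solve-∀ ℚ-ring

  vieta-σ₃ : ∀ a6 → L ℚ.* ι a6 ℚ.- ι n ℚ.* ι n ≡ ℚ.- (L ℚ.* (x 0F ℚ.* x 1F ℚ.* x 2F))
           → (π₃ C 0F 1F 2F * n) * (π₃ C 0F 1F 2F * n) ≡ l * l * (σ₃ A C 0F 1F 2F + a6 * (π₃ C 0F 1F 2F * π₃ C 0F 1F 2F))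
  vieta-σ₃ a6 La6−n²≡−Le₃ = ⟦⟧ℤ-≡-from-ℚ ((‵P ⊗ ‵ n) ²) (‵ l ² ⊗ (‵ A 0F ⊗ ‵ A 1F ⊗ ‵ A 2F ⊕ ‵ a6 ⊗ ‵P ²))
    (begin
      p ℚ.* ι n ℚ.* (p ℚ.* ι n)                                 ≡⟨ square-* p (ι n) ⟩
      p ℚ.* p ℚ.* (ι n ℚ.* ι n)                                 ≡⟨ cong (p ℚ.* p ℚ.*_) (rearrange {L ℚ.* ι a6} La6−n²≡−Le₃) ⟩
      p ℚ.* p ℚ.* (L ℚ.* ι a6 ℚ.+ L ℚ.* (x 0F ℚ.* x 1F ℚ.* x 2F)) ≡⟨ clear (c 0F) (c 1F) (c 2F) L (ι a6) (x 0F) (x 1F) (x 2F) ⟩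
      S (X 0F) (X 1F) (X 2F)                                      ≡⟨ X≡A S ⟩
      S (ι (A 0F)) (ι (A 1F)) (ι (A 2F))                          ∎)
    where
    open ≡-Reasoning
    S : ℚ → ℚ → ℚ → ℚ
    S a b d = L ℚ.* (a ℚ.* b ℚ.* d ℚ.+ ι a6 ℚ.* (p ℚ.* p))
    square-* : ∀ p n → p ℚ.* n ℚ.* (p ℚ.* n) ≡ p ℚ.* p ℚ.* (n ℚ.* n)
    square-* = RingSolver.solve-∀ ℚ-ring
    rearrange : ∀ {u v w} → u ℚ.- v ≡ ℚ.- w → v ≡ u ℚ.+ w
    rearrange {u} {v} {w} u−v≡−w = trans (shift u v) (trans (cong (λ t → u ℚ.- t) u−v≡−w) (unshift u w))
      where
      shift : ∀ u v → v ≡ u ℚ.- (u ℚ.- v)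
      shift = RingSolver.solve-∀ ℚ-ring
      unshift : ∀ u w → u ℚ.- ℚ.- w ≡ u ℚ.+ w
      unshift = RingSolver.solve-∀ ℚ-ring
    clear : ∀ c₀ c₁ c₂ L α x₀ x₁ x₂ → c₀ ℚ.* c₁ ℚ.* c₂ ℚ.* (c₀ ℚ.* c₁ ℚ.* c₂) ℚ.* (L ℚ.* α ℚ.+ L ℚ.* (x₀ ℚ.* x₁ ℚ.* x₂))
          ≡ L ℚ.* (x₀ ℚ.* (c₀ ℚ.* c₀) ℚ.* (x₁ ℚ.* (c₁ ℚ.* c₁)) ℚ.* (x₂ ℚ.* (c₂ ℚ.* c₂)) ℚ.+ α ℚ.* (c₀ ℚ.* c₁ ℚ.* c₂ ℚ.* (c₀ ℚ.* c₁ ℚ.* c₂)))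
    clear = RingSolver.solve-∀ ℚ-ring

  vieta-σ₂ : ∀ a4 → L ℚ.* ι a4 ℚ.- ι (+ 2) ℚ.* ι m ℚ.* ι n ≡ L ℚ.* (x 0F ℚ.* x 1F ℚ.+ x 0F ℚ.* x 2F ℚ.+ x 1F ℚ.* x 2F)
           → l * l * (a4 * (π₃ C 0F 1F 2F * π₃ C 0F 1F 2F)) - + 2 * (π₃ C 0F 1F 2F * m) * (π₃ C 0F 1F 2F * n)
             ≡ l * l * σ₂ A C 0F 1F 2F
  vieta-σ₂ a4 La4−2mn≡Le₂ = ⟦⟧ℤ-≡-from-ℚ (‵ l ² ⊗ (‵ a4 ⊗ ‵P ²) ⊕ ⊝ (‵ (+ 2) ⊗ (‵P ⊗ ‵ m) ⊗ (‵P ⊗ ‵ n)))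
    (‵ l ² ⊗ (‵ A 1F ⊗ ‵ A 2F ⊗ ‵ C 0F ² ⊕ ‵ A 0F ⊗ ‵ A 2F ⊗ ‵ C 1F ² ⊕ ‵ A 0F ⊗ ‵ A 1F ⊗ ‵ C 2F ²))
    (begin
      L ℚ.* (ι a4 ℚ.* (p ℚ.* p)) ℚ.- ι (+ 2) ℚ.* (p ℚ.* ι m) ℚ.* (p ℚ.* ι n)
          ≡⟨ factor p L (ι a4) (ι (+ 2)) (ι m) (ι n) ⟩
      p ℚ.* p ℚ.* (L ℚ.* ι a4 ℚ.- ι (+ 2) ℚ.* ι m ℚ.* ι n)
          ≡⟨ cong (p ℚ.* p ℚ.*_) La4−2mn≡Le₂ ⟩
      p ℚ.* p ℚ.* (L ℚ.* (x 0F ℚ.* x 1F ℚ.+ x 0F ℚ.* x 2F ℚ.+ x 1F ℚ.* x 2F))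
          ≡⟨ clear (c 0F) (c 1F) (c 2F) L (x 0F) (x 1F) (x 2F) ⟩
      S (X 0F) (X 1F) (X 2F)
          ≡⟨ X≡A S ⟩
      S (ι (A 0F)) (ι (A 1F)) (ι (A 2F))
          ∎)
    where
    open ≡-Reasoning
    S : ℚ → ℚ → ℚ → ℚ
    S a b d = L ℚ.* (b ℚ.* d ℚ.* (c 0F ℚ.* c 0F) ℚ.+ a ℚ.* d ℚ.* (c 1F ℚ.* c 1F) ℚ.+ a ℚ.* b ℚ.* (c 2F ℚ.* c 2F))
    factor : ∀ p L α two m n → L ℚ.* (α ℚ.* (p ℚ.* p)) ℚ.- two ℚ.* (p ℚ.* m) ℚ.* (p ℚ.* n)
           ≡ p ℚ.* p ℚ.* (L ℚ.* α ℚ.- two ℚ.* m ℚ.* n)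
    factor = RingSolver.solve-∀ ℚ-ring
    clear : ∀ c₀ c₁ c₂ L x₀ x₁ x₂ → c₀ ℚ.* c₁ ℚ.* c₂ ℚ.* (c₀ ℚ.* c₁ ℚ.* c₂) ℚ.* (L ℚ.* (x₀ ℚ.* x₁ ℚ.+ x₀ ℚ.* x₂ ℚ.+ x₁ ℚ.* x₂))
          ≡ L ℚ.* (x₁ ℚ.* (c₁ ℚ.* c₁) ℚ.* (x₂ ℚ.* (c₂ ℚ.* c₂)) ℚ.* (c₀ ℚ.* c₀) ℚ.+ x₀ ℚ.* (c₀ ℚ.* c₀) ℚ.* (x₂ ℚ.* (c₂ ℚ.* c₂)) ℚ.* (c₁ ℚ.* c₁)
                   ℚ.+ x₀ ℚ.* (c₀ ℚ.* c₀) ℚ.* (x₁ ℚ.* (c₁ ℚ.* c₁)) ℚ.* (c₂ ℚ.* c₂))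
    clear = RingSolver.solve-∀ ℚ-ring

unscale-σ₂ : ∀ l m n M N P a4 s → l ≢ + 0 → M * l ≡ P * m → N * l ≡ P * n
           → l * l * (a4 * (P * P)) - + 2 * (P * m) * (P * n) ≡ l * l * s → s ≡ - (+ 2 * M * N) + a4 * (P * P)
unscale-σ₂ l m n M N P a4 s l≢0 Ml≡Pm Nl≡Pn scaled = sym (ℤ.*-cancelˡ-≡ (l * l) _ _ (begin
  l * l * (- (+ 2 * M * N) + a4 * (P * P))      ≡⟨ solve (l ∷ M ∷ N ∷ P ∷ a4 ∷ []) ⟩
  l * l * (a4 * (P * P)) - + 2 * (M * l) * (N * l) ≡⟨ cong₂ (λ s t → l * l * (a4 * (P * P)) - + 2 * s * t) Ml≡Pm Nl≡Pn ⟩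
  l * l * (a4 * (P * P)) - + 2 * (P * m) * (P * n) ≡⟨ scaled ⟩
  l * l * s                                     ∎))
  where
  open ≡-Reasoning
  instance
    l*l≢0 : ℤ.NonZero (l * l)
    l*l≢0 = ℤ.i*j≢0 l l {{ℤ.≢-nonZero l≢0}} {{ℤ.≢-nonZero l≢0}}

unshift-σ₃ : ∀ N s a6 P → N * N ≡ s + a6 * (P * P) → s ≡ N * N - a6 * (P * P)
unshift-σ₃ N s a6 P N²≡s+a6P² = begin
  s                             ≡⟨ solve (s ∷ a6 ∷ P ∷ []) ⟩
  s + a6 * (P * P) - a6 * (P * P) ≡⟨ cong (_- a6 * (P * P)) N²≡s+a6P² ⟨
  N * N - a6 * (P * P)          ∎
  where open ≡-Reasoning

-- aᵢ = Aᵢ v + Cᵢ² u: the abscissae undergo x ↦ v x + u.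
σ₁-shift : ∀ A₁ A₂ A₃ C₁ C₂ C₃ u v
  → (A₁ * v + C₁ * C₁ * u) * (C₂ * C₂) * (C₃ * C₃) + (A₂ * v + C₂ * C₂ * u) * (C₁ * C₁) * (C₃ * C₃)
    + (A₃ * v + C₃ * C₃ * u) * (C₁ * C₁) * (C₂ * C₂)
  ≡ (A₁ * (C₂ * C₂) * (C₃ * C₃) + A₂ * (C₁ * C₁) * (C₃ * C₃) + A₃ * (C₁ * C₁) * (C₂ * C₂)) * v
    + + 3 * (C₁ * C₂ * C₃ * (C₁ * C₂ * C₃)) * u
σ₁-shift = solve-∀

σ₂-shift : ∀ A₁ A₂ A₃ C₁ C₂ C₃ u v
  → (A₂ * v + C₂ * C₂ * u) * (A₃ * v + C₃ * C₃ * u) * (C₁ * C₁) + (A₁ * v + C₁ * C₁ * u) * (A₃ * v + C₃ * C₃ * u) * (C₂ * C₂)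
    + (A₁ * v + C₁ * C₁ * u) * (A₂ * v + C₂ * C₂ * u) * (C₃ * C₃)
  ≡ (A₂ * A₃ * (C₁ * C₁) + A₁ * A₃ * (C₂ * C₂) + A₁ * A₂ * (C₃ * C₃)) * (v * v)
    + + 2 * (A₁ * (C₂ * C₂) * (C₃ * C₃) + A₂ * (C₁ * C₁) * (C₃ * C₃) + A₃ * (C₁ * C₁) * (C₂ * C₂)) * (u * v)
    + + 3 * (C₁ * C₂ * C₃ * (C₁ * C₂ * C₃)) * (u * u)
σ₂-shift = solve-∀

σ₃-shift : ∀ A₁ A₂ A₃ C₁ C₂ C₃ u v
  → (A₁ * v + C₁ * C₁ * u) * (A₂ * v + C₂ * C₂ * u) * (A₃ * v + C₃ * C₃ * u)
  ≡ A₁ * A₂ * A₃ * (v * v * v)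
    + (A₂ * A₃ * (C₁ * C₁) + A₁ * A₃ * (C₂ * C₂) + A₁ * A₂ * (C₃ * C₃)) * (v * v * u)
    + (A₁ * (C₂ * C₂) * (C₃ * C₃) + A₂ * (C₁ * C₁) * (C₃ * C₃) + A₃ * (C₁ * C₁) * (C₂ * C₂)) * (v * u * u)
    + C₁ * C₂ * C₃ * (C₁ * C₂ * C₃) * (u * u * u)
σ₃-shift = solve-∀

module _ (a4 a6 u v M N : ℤ) (A C : Fin 3 → ℤ)
  (σ₁≡M² : σ₁ A C 0F 1F 2F ≡ M * M)
  (σ₂≡a4P²−2MN : σ₂ A C 0F 1F 2F ≡ - (+ 2 * M * N) + a4 * (π₃ C 0F 1F 2F * π₃ C 0F 1F 2F))
  (σ₃≡N²−a6P² : σ₃ A C 0F 1F 2F ≡ N * N - a6 * (π₃ C 0F 1F 2F * π₃ C 0F 1F 2F)) where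

  private
    a : Fin 3 → ℤ
    a i = A i * v + C i * C i * u
    P b : ℤ
    P = π₃ C 0F 1F 2F
    b = N * v - M * u
    open ≡-Reasoning

  shifted-σ₁ : σ₁ a C 0F 1F 2F ≡ M * M * v + + 3 * (P * P) * u
  shifted-σ₁ = trans (σ₁-shift (A 0F) (A 1F) (A 2F) (C 0F) (C 1F) (C 2F) u v)
                     (cong (λ s₁ → s₁ * v + + 3 * (P * P) * u) σ₁≡M²)

  shifted-σ₂ : σ₂ a C 0F 1F 2F ≡ - (+ 2 * M * b * v) + P * P * (+ 3 * u * u + a4 * v * v)
  shifted-σ₂ = begin
    σ₂ a C 0F 1F 2F
      ≡⟨ σ₂-shift (A 0F) (A 1F) (A 2F) (C 0F) (C 1F) (C 2F) u v ⟩
    σ₂ A C 0F 1F 2F * (v * v) + + 2 * σ₁ A C 0F 1F 2F * (u * v) + + 3 * (P * P) * (u * u)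
      ≡⟨ cong₂ (λ s₂ s₁ → s₂ * (v * v) + + 2 * s₁ * (u * v) + + 3 * (P * P) * (u * u)) σ₂≡a4P²−2MN σ₁≡M² ⟩
    (- (+ 2 * M * N) + a4 * (P * P)) * (v * v) + + 2 * (M * M) * (u * v) + + 3 * (P * P) * (u * u)
      ≡⟨ collapse M N P u v a4 ⟩
    - (+ 2 * M * b * v) + P * P * (+ 3 * u * u + a4 * v * v)
      ∎
    where
    collapse : ∀ M N P u v a4 → (- (+ 2 * M * N) + a4 * (P * P)) * (v * v) + + 2 * (M * M) * (u * v) + + 3 * (P * P) * (u * u)
             ≡ - (+ 2 * M * (N * v - M * u) * v) + P * P * (+ 3 * u * u + a4 * v * v)
    collapse = solve-∀

  shifted-σ₃ : σ₃ a C 0F 1F 2F * v ≡ b * b * (v * v) + P * P * dE a4 a6 u v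
  shifted-σ₃ = begin
    σ₃ a C 0F 1F 2F * v
      ≡⟨ cong (_* v) (σ₃-shift (A 0F) (A 1F) (A 2F) (C 0F) (C 1F) (C 2F) u v) ⟩
    (σ₃ A C 0F 1F 2F * (v * v * v) + σ₂ A C 0F 1F 2F * (v * v * u) + σ₁ A C 0F 1F 2F * (v * u * u) + P * P * (u * u * u)) * v
      ≡⟨ cong₃ (λ s₃ s₂ s₁ → (s₃ * (v * v * v) + s₂ * (v * v * u) + s₁ * (v * u * u) + P * P * (u * u * u)) * v)
               σ₃≡N²−a6P² σ₂≡a4P²−2MN σ₁≡M² ⟩
    ((N * N - a6 * (P * P)) * (v * v * v) + (- (+ 2 * M * N) + a4 * (P * P)) * (v * v * u) + M * M * (v * u * u)
      + P * P * (u * u * u)) * v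
      ≡⟨ collapse M N P u v a4 a6 ⟩
    b * b * (v * v) + P * P * dE a4 a6 u v
      ∎
    where
    collapse : ∀ M N P u v a4 a6
      → ((N * N - a6 * (P * P)) * (v * v * v) + (- (+ 2 * M * N) + a4 * (P * P)) * (v * v * u) + M * M * (v * u * u)
          + P * P * (u * u * u)) * v
      ≡ (N * v - M * u) * (N * v - M * u) * (v * v) + P * P * (v * (u * u * u + a4 * u * v * v - a6 * v * v * v))
    collapse = solve-∀

module _ {A : Set} (f : Fin 3 → Fin 3 → Fin 3 → A)
         (swap₁₂ : ∀ i j k → f i j k ≡ f j i k) (swap₂₃ : ∀ i j k → f i j k ≡ f i k j) where

  symmetric-on-distinct : ∀ i j k → i ≢ j → i ≢ k → j ≢ k → f i j k ≡ f 0F 1F 2F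
  symmetric-on-distinct 0F 1F 2F _ _ _ = refl
  symmetric-on-distinct 0F 2F 1F _ _ _ = swap₂₃ 0F 2F 1F
  symmetric-on-distinct 1F 0F 2F _ _ _ = swap₁₂ 1F 0F 2F
  symmetric-on-distinct 1F 2F 0F _ _ _ = trans (swap₂₃ 1F 2F 0F) (swap₁₂ 1F 0F 2F)
  symmetric-on-distinct 2F 0F 1F _ _ _ = trans (swap₁₂ 2F 0F 1F) (swap₂₃ 0F 2F 1F)
  symmetric-on-distinct 2F 1F 0F _ _ _ =
    trans (swap₁₂ 2F 1F 0F) (trans (swap₂₃ 1F 2F 0F) (swap₁₂ 1F 0F 2F))
  symmetric-on-distinct 0F 0F _  i≢j _ _ = contradiction refl i≢j
  symmetric-on-distinct 1F 1F _  i≢j _ _ = contradiction refl i≢j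
  symmetric-on-distinct 2F 2F _  i≢j _ _ = contradiction refl i≢j
  symmetric-on-distinct 0F _  0F _ i≢k _ = contradiction refl i≢k
  symmetric-on-distinct 1F _  1F _ i≢k _ = contradiction refl i≢k
  symmetric-on-distinct 2F _  2F _ i≢k _ = contradiction refl i≢k
  symmetric-on-distinct _  0F 0F _ _ j≢k = contradiction refl j≢k
  symmetric-on-distinct _  1F 1F _ _ j≢k = contradiction refl j≢k
  symmetric-on-distinct _  2F 2F _ _ j≢k = contradiction refl j≢k

module _ (A C : Fin 3 → ℤ) where

  σ₁-on-distinct : ∀ i j k → i ≢ j → i ≢ k → j ≢ k → σ₁ A C i j k ≡ σ₁ A C 0F 1F 2F
  σ₁-on-distinct = symmetric-on-distinct (σ₁ A C)
    (λ i j k → swap₁₂ (A i) (A j) (A k) (C i) (C j) (C k)) (λ i j k → swap₂₃ (A i) (A j) (A k) (C i) (C j) (C k))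
    where
    swap₁₂ : ∀ a b d c e g → a * (e * e) * (g * g) + b * (c * c) * (g * g) + d * (c * c) * (e * e)
                           ≡ b * (c * c) * (g * g) + a * (e * e) * (g * g) + d * (e * e) * (c * c)
    swap₁₂ = solve-∀
    swap₂₃ : ∀ a b d c e g → a * (e * e) * (g * g) + b * (c * c) * (g * g) + d * (c * c) * (e * e)
                           ≡ a * (g * g) * (e * e) + d * (c * c) * (e * e) + b * (c * c) * (g * g)
    swap₂₃ = solve-∀

  σ₂-on-distinct : ∀ i j k → i ≢ j → i ≢ k → j ≢ k → σ₂ A C i j k ≡ σ₂ A C 0F 1F 2F
  σ₂-on-distinct = symmetric-on-distinct (σ₂ A C)
    (λ i j k → swap₁₂ (A i) (A j) (A k) (C i) (C j) (C k)) (λ i j k → swap₂₃ (A i) (A j) (A k) (C i) (C j) (C k))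
    where
    swap₁₂ : ∀ a b d c e g → b * d * (c * c) + a * d * (e * e) + a * b * (g * g)
                           ≡ a * d * (e * e) + b * d * (c * c) + b * a * (g * g)
    swap₁₂ = solve-∀
    swap₂₃ : ∀ a b d c e g → b * d * (c * c) + a * d * (e * e) + a * b * (g * g)
                           ≡ d * b * (c * c) + a * b * (g * g) + a * d * (e * e)
    swap₂₃ = solve-∀

π₃-on-distinct : ∀ (C : Fin 3 → ℤ) i j k → i ≢ j → i ≢ k → j ≢ k → π₃ C i j k ≡ π₃ C 0F 1F 2F
π₃-on-distinct C = symmetric-on-distinct (π₃ C)
  (λ i j k → swap₁₂ (C i) (C j) (C k)) (λ i j k → swap₂₃ (C i) (C j) (C k))
  where
  swap₁₂ : ∀ c e g → c * e * g ≡ e * c * g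
  swap₁₂ = solve-∀
  swap₂₃ : ∀ c e g → c * e * g ≡ c * g * e
  swap₂₃ = solve-∀

module _ (a4 a6 M N : ℤ) (A B C : Fin 3 → ℤ) (i j k : Fin 3)
  (σ₁≡M² : σ₁ A C i j k ≡ M * M)
  (σ₂≡a4P²−2MN : σ₂ A C i j k ≡ - (+ 2 * M * N) + a4 * (π₃ C i j k * π₃ C i j k))
  (on-scaled-line : M * A k + N * (C k * C k) ≡ C i * C j * B k)
  (on-curveₖ : B k * B k ≡ A k * A k * A k + a4 * A k * (C k * C k * (C k * C k)) + a6 * (C k * C k * C k * (C k * C k * C k)))
  (Cₖ⊥Aₖ : ℤ.Coprime (C k) (A k)) (Cₖ>0 : + 0 < C k) where

  private
    K : ℤ
    K = C k * C k
    instance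
      Cₖ≢0 : ℤ.NonZero (C k)
      Cₖ≢0 = ℤ.>-nonZero Cₖ>0
      K≢0 : ℤ.NonZero K
      K≢0 = ℤ.i*j≢0 (C k) (C k)
      K²≢0 : ℤ.NonZero (K * K)
      K²≢0 = ℤ.i*j≢0 K K
    K⊥Aₖ : ℤ.Coprime K (A k)
    K⊥Aₖ = coprime-square (C k) (A k) Cₖ⊥Aₖ

  CᵢCⱼ∣MN+AᵢAⱼCₖ² : C i * C j ∣ M * N + A i * A j * (C k * C k)
  CᵢCⱼ∣MN+AᵢAⱼCₖ² = *≡*∧∣⇒∣ (C i * C j) T X K scaled (coprime-*≡*⇒∣ K (A k) X K⊥Aₖ reduced)
    where
    T X : ℤ
    T = M * N + A i * A j * K
    X = a4 * (C i * C j) * (K * K) - M * B k + A k * A k * (C i * C j)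
    scaled : T * K ≡ C i * C j * X
    scaled = combination₃ K (- A k) (- M) (certificate (A i) (A j) (A k) (B k) (C i) (C j) (C k) M N a4)
                          σ₂≡a4P²−2MN σ₁≡M² on-scaled-line
      where
      certificate : ∀ Aᵢ Aⱼ Aₖ Bₖ Cᵢ Cⱼ Cₖ M N a4 → (M * N + Aᵢ * Aⱼ * (Cₖ * Cₖ)) * (Cₖ * Cₖ)
        ≡ Cᵢ * Cⱼ * (a4 * (Cᵢ * Cⱼ) * ((Cₖ * Cₖ) * (Cₖ * Cₖ)) - M * Bₖ + Aₖ * Aₖ * (Cᵢ * Cⱼ))
          + (Cₖ * Cₖ * (Aⱼ * Aₖ * (Cᵢ * Cᵢ) + Aᵢ * Aₖ * (Cⱼ * Cⱼ) + Aᵢ * Aⱼ * (Cₖ * Cₖ) - (- (+ 2 * M * N) + a4 * (Cᵢ * Cⱼ * Cₖ * (Cᵢ * Cⱼ * Cₖ))))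
            + - Aₖ * (Aᵢ * (Cⱼ * Cⱼ) * (Cₖ * Cₖ) + Aⱼ * (Cᵢ * Cᵢ) * (Cₖ * Cₖ) + Aₖ * (Cᵢ * Cᵢ) * (Cⱼ * Cⱼ) - M * M)
            + - M * (M * Aₖ + N * (Cₖ * Cₖ) - Cᵢ * Cⱼ * Bₖ))
      certificate = solve-∀
    reduced : A k * X ≡ K * (N * B k - a6 * (C i * C j) * (K * K))
    reduced = combination₂ (- (C i * C j)) (- B k) (certificate (A k) (B k) (C i) (C j) (C k) M N a4 a6) on-curveₖ on-scaled-line
      where
      certificate : ∀ Aₖ Bₖ Cᵢ Cⱼ Cₖ M N a4 a6 → Aₖ * (a4 * (Cᵢ * Cⱼ) * ((Cₖ * Cₖ) * (Cₖ * Cₖ)) - M * Bₖ + Aₖ * Aₖ * (Cᵢ * Cⱼ))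
        ≡ Cₖ * Cₖ * (N * Bₖ - a6 * (Cᵢ * Cⱼ) * ((Cₖ * Cₖ) * (Cₖ * Cₖ)))
          + (- (Cᵢ * Cⱼ) * (Bₖ * Bₖ - (Aₖ * Aₖ * Aₖ + a4 * Aₖ * (Cₖ * Cₖ * (Cₖ * Cₖ)) + a6 * (Cₖ * Cₖ * Cₖ * (Cₖ * Cₖ * Cₖ))))
            + - Bₖ * (M * Aₖ + N * (Cₖ * Cₖ) - Cᵢ * Cⱼ * Bₖ))
      certificate = solve-∀

  CᵢCⱼ∣AᵢAⱼM+AᵢCⱼ²N+AⱼCᵢ²N : C i * C j ∣ A i * A j * M + A i * (C j * C j) * N + A j * (C i * C i) * N
  CᵢCⱼ∣AᵢAⱼM+AᵢCⱼ²N+AⱼCᵢ²N = *≡*∧∣⇒∣ (C i * C j) T X (K * K) scaled K²∣X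
    where
    T X Z : ℤ
    T = A i * A j * M + A i * (C j * C j) * N + A j * (C i * C i) * N
    X = a4 * M * (C i * C j) * (K * K) - M * M * B k + M * (A k * A k) * (C i * C j) - N * A k * (C i * C j) * K
    Z = M * N * B k - a6 * (C i * C j) * M * (K * K) - N * (A k * A k) * (C i * C j)
    scaled : T * (K * K) ≡ C i * C j * X
    scaled = combination₃ (M * K) (N * K - M * A k) (- (M * M))
                          (certificate (A i) (A j) (A k) (B k) (C i) (C j) (C k) M N a4) σ₂≡a4P²−2MN σ₁≡M² on-scaled-line
      where
      certificate : ∀ Aᵢ Aⱼ Aₖ Bₖ Cᵢ Cⱼ Cₖ M N a4
        → (Aᵢ * Aⱼ * M + Aᵢ * (Cⱼ * Cⱼ) * N + Aⱼ * (Cᵢ * Cᵢ) * N) * ((Cₖ * Cₖ) * (Cₖ * Cₖ))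
        ≡ Cᵢ * Cⱼ * (a4 * M * (Cᵢ * Cⱼ) * ((Cₖ * Cₖ) * (Cₖ * Cₖ)) - M * M * Bₖ + M * (Aₖ * Aₖ) * (Cᵢ * Cⱼ) - N * Aₖ * (Cᵢ * Cⱼ) * (Cₖ * Cₖ))
          + (M * (Cₖ * Cₖ) * (Aⱼ * Aₖ * (Cᵢ * Cᵢ) + Aᵢ * Aₖ * (Cⱼ * Cⱼ) + Aᵢ * Aⱼ * (Cₖ * Cₖ) - (- (+ 2 * M * N) + a4 * (Cᵢ * Cⱼ * Cₖ * (Cᵢ * Cⱼ * Cₖ))))
            + (N * (Cₖ * Cₖ) - M * Aₖ) * (Aᵢ * (Cⱼ * Cⱼ) * (Cₖ * Cₖ) + Aⱼ * (Cᵢ * Cᵢ) * (Cₖ * Cₖ) + Aₖ * (Cᵢ * Cᵢ) * (Cⱼ * Cⱼ) - M * M)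
            + - (M * M) * (M * Aₖ + N * (Cₖ * Cₖ) - Cᵢ * Cⱼ * Bₖ))
      certificate = solve-∀
    reduced : A k * X ≡ K * Z
    reduced = combination₂ (- (C i * C j * M)) (- (M * B k)) (certificate (A k) (B k) (C i) (C j) (C k) M N a4 a6) on-curveₖ on-scaled-line
      where
      certificate : ∀ Aₖ Bₖ Cᵢ Cⱼ Cₖ M N a4 a6
        → Aₖ * (a4 * M * (Cᵢ * Cⱼ) * ((Cₖ * Cₖ) * (Cₖ * Cₖ)) - M * M * Bₖ + M * (Aₖ * Aₖ) * (Cᵢ * Cⱼ) - N * Aₖ * (Cᵢ * Cⱼ) * (Cₖ * Cₖ))
        ≡ Cₖ * Cₖ * (M * N * Bₖ - a6 * (Cᵢ * Cⱼ) * M * ((Cₖ * Cₖ) * (Cₖ * Cₖ)) - N * (Aₖ * Aₖ) * (Cᵢ * Cⱼ))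
          + (- (Cᵢ * Cⱼ * M) * (Bₖ * Bₖ - (Aₖ * Aₖ * Aₖ + a4 * Aₖ * (Cₖ * Cₖ * (Cₖ * Cₖ)) + a6 * (Cₖ * Cₖ * Cₖ * (Cₖ * Cₖ * Cₖ))))
            + - (M * Bₖ) * (M * Aₖ + N * (Cₖ * Cₖ) - Cᵢ * Cⱼ * Bₖ))
      certificate = solve-∀
    reduced′ : A k * Z ≡ K * (- (N * N * B k) - a6 * (C i * C j) * M * A k * K + N * (C i * C j) * (a4 * A k * K + a6 * (K * K)))
    reduced′ = combination₂ (N * (C i * C j)) (N * B k) (certificate (A k) (B k) (C i) (C j) (C k) M N a4 a6) on-curveₖ on-scaled-line
      where
      certificate : ∀ Aₖ Bₖ Cᵢ Cⱼ Cₖ M N a4 a6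
        → Aₖ * (M * N * Bₖ - a6 * (Cᵢ * Cⱼ) * M * ((Cₖ * Cₖ) * (Cₖ * Cₖ)) - N * (Aₖ * Aₖ) * (Cᵢ * Cⱼ))
        ≡ Cₖ * Cₖ * (- (N * N * Bₖ) - a6 * (Cᵢ * Cⱼ) * M * Aₖ * (Cₖ * Cₖ) + N * (Cᵢ * Cⱼ) * (a4 * Aₖ * (Cₖ * Cₖ) + a6 * ((Cₖ * Cₖ) * (Cₖ * Cₖ))))
          + (N * (Cᵢ * Cⱼ) * (Bₖ * Bₖ - (Aₖ * Aₖ * Aₖ + a4 * Aₖ * (Cₖ * Cₖ * (Cₖ * Cₖ)) + a6 * (Cₖ * Cₖ * Cₖ * (Cₖ * Cₖ * Cₖ))))
            + N * Bₖ * (M * Aₖ + N * (Cₖ * Cₖ) - Cᵢ * Cⱼ * Bₖ))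
      certificate = solve-∀
    K²∣X : K * K ∣ X
    K²∣X = ℤ.coprime-divisor (K * K) (A k) X (coprime-square K (A k) K⊥Aₖ)
             (subst (K * K ∣_) (sym reduced) (ℤ.*-monoʳ-∣ K {K} {Z} (coprime-*≡*⇒∣ K (A k) Z K⊥Aₖ reduced′)))

pair-divisibilities : ∀ a4 a6 l m n M N (x y : Fin 3 → ℚ) (A B C : Fin 3 → ℤ)
  → (∀ k → OnCurve a4 a6 (x k) (y k))
  → (∀ k → x k ℚ.* ι (C k * C k) ≡ ι (A k)) → (∀ k → y k ℚ.* ι (C k * C k * C k) ≡ ι (B k))
  → (∀ k → gcd (A k) (C k) ≡ + 1) → (∀ k → + 0 < C k)
  → l ≢ + 0 → (∀ k → ι l ℚ.* y k ≡ ι m ℚ.* x k ℚ.+ ι n)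
  → M * l ≡ π₃ C 0F 1F 2F * m → N * l ≡ π₃ C 0F 1F 2F * n
  → σ₁ A C 0F 1F 2F ≡ M * M → σ₂ A C 0F 1F 2F ≡ - (+ 2 * M * N) + a4 * (π₃ C 0F 1F 2F * π₃ C 0F 1F 2F)
  → ∀ i j k → i ≢ j → i ≢ k → j ≢ k
  → (C i * C j ∣ M * N + A i * A j * (C k * C k))
    × (C i * C j ∣ A i * A j * M + A i * (C j * C j) * N + A j * (C i * C i) * N)
pair-divisibilities a4 a6 l m n M N x y A B C
                    on-curve x*C²≡A y*C³≡B gcd[A,C]≡1 C>0 l≢0 on-line Ml≡Pm Nl≡Pn σ₁≡M² σ₂≡a4P²−2MN i j k i≢j i≢k j≢k =
  CᵢCⱼ∣MN+AᵢAⱼCₖ² a4 a6 M N A B C i j k σ₁ᵢⱼₖ σ₂ᵢⱼₖ on-scaled-line on-curveₖ Cₖ⊥Aₖ (C>0 k) ,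
  CᵢCⱼ∣AᵢAⱼM+AᵢCⱼ²N+AⱼCᵢ²N a4 a6 M N A B C i j k σ₁ᵢⱼₖ σ₂ᵢⱼₖ on-scaled-line on-curveₖ Cₖ⊥Aₖ (C>0 k)
  where
  Pᵢⱼₖ≡P : π₃ C i j k ≡ π₃ C 0F 1F 2F
  Pᵢⱼₖ≡P = π₃-on-distinct C i j k i≢j i≢k j≢k
  σ₁ᵢⱼₖ : σ₁ A C i j k ≡ M * M
  σ₁ᵢⱼₖ = trans (σ₁-on-distinct A C i j k i≢j i≢k j≢k) σ₁≡M²
  σ₂ᵢⱼₖ : σ₂ A C i j k ≡ - (+ 2 * M * N) + a4 * (π₃ C i j k * π₃ C i j k)
  σ₂ᵢⱼₖ = trans (σ₂-on-distinct A C i j k i≢j i≢k j≢k)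
                (trans σ₂≡a4P²−2MN (cong (λ Q → - (+ 2 * M * N) + a4 * (Q * Q)) (sym Pᵢⱼₖ≡P)))
  on-scaled-line : M * A k + N * (C k * C k) ≡ C i * C j * B k
  on-scaled-line = integral-onScaledLine l m n (π₃ C 0F 1F 2F) (C i * C j) (C k) M N (A k) (B k) l≢0 Ml≡Pm Nl≡Pn
    (sym Pᵢⱼₖ≡P) (integral-onLine (x k) (y k) (A k) (B k) (C k) (x*C²≡A k) (y*C³≡B k) l m n (on-line k))
  on-curveₖ : B k * B k ≡ A k * A k * A k + a4 * A k * (C k * C k * (C k * C k)) + a6 * (C k * C k * C k * (C k * C k * C k))
  on-curveₖ = integral-onCurve (x k) (y k) (A k) (B k) (C k) (x*C²≡A k) (y*C³≡B k) a4 a6 (on-curve k)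
  Cₖ⊥Aₖ : ℤ.Coprime (C k) (A k)
  Cₖ⊥Aₖ = ℕ.sym (ℕ.gcd≡1⇒coprime (cong ℤ.∣_∣ (gcd[A,C]≡1 k)))

lemma2p6 : (a4 a6 u v : ℤ) → IsElliptic a4 a6
    → MapSuitable a4 a6 u v
    → NegFundamentalDisc (- DE a4 a6 u v)
    → (x y : Fin 3 → ℚ) → (A B C : Fin 3 → ℤ)
    → (∀ i → OnCurve a4 a6 (x i) (y i))
    → addPt a4 (addPt a4 (af (x zero) (y zero)) (af (x (suc zero)) (y (suc zero))))
               (af (x (suc (suc zero))) (y (suc (suc zero)))) ≡ 𝒪
    → (∀ i → x i ℚ.* ι (C i * C i) ≡ ι (A i))
    → (∀ i → y i ℚ.* ι (C i * C i * C i) ≡ ι (B i))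
    → (∀ i → gcd (A i) (C i) ≡ + 1)
    → (∀ i → gcd (B i) (C i) ≡ + 1)
    → (∀ i → + 0 < C i)
    → (l m n : ℤ)
    → LineMeetsExactly a4 a6 l m n (x zero) (y zero) (x (suc zero)) (y (suc zero))
                                   (x (suc (suc zero))) (y (suc (suc zero)))
    → let d = dE a4 a6 u v
          A₁ = A zero
          A₂ = A (suc zero)
          A₃ = A (suc (suc zero))
          C₁ = C zero
          C₂ = C (suc zero)
          C₃ = C (suc (suc zero))
          Cp = C₁ * C₂ * C₃
          a : Fin 3 → ℤ
          a i = A i * v + C i * C i * u
          a₁ = a zero
          a₂ = a (suc zero)
          a₃ = a (suc (suc zero))
      in Σ ℤ λ M → Σ ℤ λ N →
         let b = N * v - M * u in
         (M * l ≡ Cp * m) × (N * l ≡ Cp * n)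
         × (a₁ * a₂ * a₃ * v ≡ b * b * (v * v) + Cp * Cp * d)
         × (A₁ * A₂ * A₃ ≡ N * N - a6 * (Cp * Cp))
         × (a₂ * a₃ * (C₁ * C₁) + a₁ * a₃ * (C₂ * C₂) + a₁ * a₂ * (C₃ * C₃)
              ≡ - (+ 2 * M * b * v) + Cp * Cp * (+ 3 * u * u + a4 * v * v))
         × (A₂ * A₃ * (C₁ * C₁) + A₁ * A₃ * (C₂ * C₂) + A₁ * A₂ * (C₃ * C₃)
              ≡ - (+ 2 * M * N) + a4 * (Cp * Cp))
         × (a₁ * (C₂ * C₂) * (C₃ * C₃) + a₂ * (C₁ * C₁) * (C₃ * C₃) + a₃ * (C₁ * C₁) * (C₂ * C₂)
              ≡ M * M * v + + 3 * (Cp * Cp) * u)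
         × (A₁ * (C₂ * C₂) * (C₃ * C₃) + A₂ * (C₁ * C₁) * (C₃ * C₃) + A₃ * (C₁ * C₁) * (C₂ * C₂)
              ≡ M * M)
         × (∀ (i j k : Fin 3) → i ≢ j → i ≢ k → j ≢ k
              → ((C i * C j) ∣ (M * N + A i * A j * (C k * C k)))
                × ((C i * C j) ∣ (A i * A j * M + A i * (C j * C j) * N + A j * (C i * C i) * N)))
lemma2p6 a4 a6 u v _ _ _ x y A B C on-curve _ x*C²≡A y*C³≡B gcd[A,C]≡1 _ C>0 l m n
         (l≢0 , on-line₀ , on-line₁ , on-line₂ , vieta₁ , vieta₂ , vieta₃)
  = M , N , Ml≡Pm , Nl≡Pn ,
    shifted-σ₃ a4 a6 u v M N A C σ₁≡M² σ₂≡a4P²−2MN σ₃≡N²−a6P² , σ₃≡N²−a6P² ,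
    shifted-σ₂ a4 a6 u v M N A C σ₁≡M² σ₂≡a4P²−2MN σ₃≡N²−a6P² , σ₂≡a4P²−2MN ,
    shifted-σ₁ a4 a6 u v M N A C σ₁≡M² σ₂≡a4P²−2MN σ₃≡N²−a6P² , σ₁≡M² ,
    pair-divisibilities a4 a6 l m n M N x y A B C on-curve x*C²≡A y*C³≡B gcd[A,C]≡1 C>0 l≢0 on-line
                        Ml≡Pm Nl≡Pn σ₁≡M² σ₂≡a4P²−2MN
  where
  P : ℤ
  P = π₃ C 0F 1F 2F
  M-facts : Σ[ M ∈ ℤ ] (M * l ≡ P * m × M * M ≡ σ₁ A C 0F 1F 2F)
  M-facts = quotient-of-squares l (P * m) (σ₁ A C 0F 1F 2F) l≢0 (vieta-σ₁ x A C x*C²≡A l m n vieta₁)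
  N-facts : Σ[ N ∈ ℤ ] (N * l ≡ P * n × N * N ≡ σ₃ A C 0F 1F 2F + a6 * (P * P))
  N-facts = quotient-of-squares l (P * n) (σ₃ A C 0F 1F 2F + a6 * (P * P)) l≢0
              (vieta-σ₃ x A C x*C²≡A l m n a6 vieta₃)
  M N : ℤ
  M = proj₁ M-facts
  N = proj₁ N-facts
  Ml≡Pm : M * l ≡ P * m
  Ml≡Pm = proj₁ (proj₂ M-facts)
  Nl≡Pn : N * l ≡ P * n
  Nl≡Pn = proj₁ (proj₂ N-facts)
  σ₁≡M² : σ₁ A C 0F 1F 2F ≡ M * M
  σ₁≡M² = sym (proj₂ (proj₂ M-facts))
  σ₂≡a4P²−2MN : σ₂ A C 0F 1F 2F ≡ - (+ 2 * M * N) + a4 * (P * P)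
  σ₂≡a4P²−2MN = unscale-σ₂ l m n M N P a4 (σ₂ A C 0F 1F 2F) l≢0 Ml≡Pm Nl≡Pn
                  (vieta-σ₂ x A C x*C²≡A l m n a4 vieta₂)
  σ₃≡N²−a6P² : σ₃ A C 0F 1F 2F ≡ N * N - a6 * (P * P)
  σ₃≡N²−a6P² = unshift-σ₃ N (σ₃ A C 0F 1F 2F) a6 P (proj₂ (proj₂ N-facts))
  on-line : ∀ k → ι l ℚ.* y k ≡ ι m ℚ.* x k ℚ.+ ι n
  on-line 0F = on-line₀
  on-line 1F = on-line₁
  on-line 2F = on-line₂
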